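{- For all closed SCL-terms $P$ and $Q$, $$\mathrm{FSCL}\vdash P=Q\quad\Longrightarrow\quad \mathrm{EqFSCL}\vdash P=Q .$$
   Context: Fix a countable set $A$ of atoms, treated as constants. $\curlywedge$ and $\curlyvee$ denote the binary connectives left-sequential (short-circuit) conjunction and disjunction. SCL-terms are terms built from variables, the constants $\mathsf T,\mathsf F$, atoms $a\in A$, the unary $\neg$ and the binary $\curlywedge,\curlyvee$; closed SCL-terms contain no variables. $\vdash$ is derivability in equational logic. CP is the following set of axioms over the signature with constants $\mathsf T,\mathsf F$, atoms, and the ternary conditional $x\triangleleft y\triangleright z$ (read: if $y$ then $x$ else $z$): (CP1) $x\triangleleft\mathsf T\triangleright y=x$; (CP2) $x\triangleleft\mathsf F\triangleright y=y$; (CP3) $\mathsf T\triangleleft x\triangleright\mathsf F=x$; (CP4) $x\triangleleft(y\triangleleft z\triangleright u)\triangleright v=(x\triangleleft y\triangleright v)\triangleleft z\triangleright(x\triangleleft u\triangleright v)$. FSCL (free short-circuit logic): for SCL-terms $t,t'$, $\mathrm{FSCL}\vdash t=t'$ means that $t=t'$ is derivable in equational logic from CP together with the defining equations $\neg x=\mathsf F\triangleleft x\triangleright\mathsf T$, $x\curlywedge y=y\triangleleft x\triangleright\mathsf F$, and $x\curlyvee y=\neg(\neg x\curlywedge\neg y)$. EqFSCL is the following set of equations over SCL-terms: (SCL1) $\mathsf F=\neg\mathsf T$; (SCL2) $x\curlyvee y=\neg(\neg x\curlywedge\neg y)$; (SCL3) $\neg\neg x=x$; (SCL4) $\mathsf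 T\curlywedge x=x$; (SCL5) $x\curlywedge\mathsf T=x$; (SCL6) $\mathsf F\curlywedge x=\mathsf F$; (SCL7) $(x\curlywedge y)\curlywedge z=x\curlywedge(y\curlywedge z)$; (SCL8) $x\curlywedge\mathsf F=\neg x\curlywedge\mathsf F$; (SCL9) $(x\curlywedge\mathsf F)\curlyvee y=(x\curlyvee\mathsf T)\curlywedge y$; (SCL10) $(x\curlywedge y)\curlyvee(z\curlywedge\mathsf F)=(x\curlyvee(z\curlywedge\mathsf F))\curlywedge(y\curlyvee(z\curlywedge\mathsf F))$. -}

module Defs where

open import Data.Nat.Base using (ℕ)
open import Data.Vec.Base using (Vec; []; _∷_)
open import Data.Vec.Relation.Binary.Pointwise.Inductive using (Pointwise)
open import Data.Vec.Relation.Unary.All using (All)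
open import Level using (Level) renaming (suc to lsuc)
open import Relation.Binary.Core using (Rel)
open import Relation.Binary.Construct.Union using (_∪_)

private variable
  a : Level

record Signature (a : Level) : Set (lsuc a) where
  field
    Op    : Set a
    arity : Op → ℕ

open Signature public

data Term (S : Signature a) : Set a where
  var : ℕ → Term S
  op  : (f : Op S) → Vec (Term S) (arity S f) → Term S

data Closed {S : Signature a} : Term S → Set a where
  op : ∀ {f ts} → All Closed ts → Closed (op f ts)

Substitution : Signature a → Set a
Substitution S = ℕ → Term S

mutual
  infixl 20 _[_] _[_]*

  _[_] : {S : Signature a} → Term S → Substitution S → Term S
  var i   [ σ ] = σ i
  op f ts [ σ ] = op f (ts [ σ ]*)

  _[_]* : {S : Signature a} {n : ℕ} →
          Vec (Term S) n → Substitution S → Vec (Term S) n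
  []       [ σ ]* = []
  (t ∷ ts) [ σ ]* = (t [ σ ]) ∷ (ts [ σ ]*)

infix 4 _⊢_≈_

data _⊢_≈_ {S : Signature a} (E : Rel (Term S) a) : Rel (Term S) a where
  axiom : ∀ {s t} → E s t → E ⊢ s ≈ t
  refl  : ∀ {t} → E ⊢ t ≈ t
  sym   : ∀ {s t} → E ⊢ s ≈ t → E ⊢ t ≈ s
  trans : ∀ {s t u} → E ⊢ s ≈ t → E ⊢ t ≈ u → E ⊢ s ≈ u
  cong  : ∀ {f ss ts} → Pointwise (E ⊢_≈_) ss ts → E ⊢ op f ss ≈ op f ts
  subst : ∀ {s t} (σ : Substitution S) →
          E ⊢ s ≈ t → E ⊢ s [ σ ] ≈ t [ σ ]

private
  x y z u v : {S : Signature a} → Term S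
  x = var 0
  y = var 1
  z = var 2
  u = var 3
  v = var 4

data SCLOp (A : Set a) : Set a where
  true false : SCLOp A
  atom       : A → SCLOp A
  not        : SCLOp A
  and or     : SCLOp A

sclArity : {A : Set a} → SCLOp A → ℕ
sclArity true     = 0
sclArity false    = 0
sclArity (atom _) = 0
sclArity not      = 1
sclArity and      = 2
sclArity or       = 2

SCL : Set a → Signature a
SCL A = record { Op = SCLOp A ; arity = sclArity }

module SCLSyntax where
  infix  8 ¬_
  infixr 7 _⋏_
  infixr 6 _⋎_

  pattern T       = op true []
  pattern F       = op false []
  pattern ¬_ s    = op not (s ∷ [])
  pattern _⋏_ s t = op and (s ∷ t ∷ [])
  pattern _⋎_ s t = op or (s ∷ t ∷ [])

module _ where
  open SCLSyntax

  data EqFSCL (A : Set a) : Rel (Term (SCL A)) a where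
    SCL1  : EqFSCL A F (¬ T)
    SCL2  : EqFSCL A (x ⋎ y) (¬ (¬ x ⋏ ¬ y))
    SCL3  : EqFSCL A (¬ ¬ x) x
    SCL4  : EqFSCL A (T ⋏ x) x
    SCL5  : EqFSCL A (x ⋏ T) x
    SCL6  : EqFSCL A (F ⋏ x) F
    SCL7  : EqFSCL A ((x ⋏ y) ⋏ z) (x ⋏ (y ⋏ z))
    SCL8  : EqFSCL A (x ⋏ F) (¬ x ⋏ F)
    SCL9  : EqFSCL A ((x ⋏ F) ⋎ y) ((x ⋎ T) ⋏ y)
    SCL10 : EqFSCL A ((x ⋏ y) ⋎ (z ⋏ F)) ((x ⋎ (z ⋏ F)) ⋏ (y ⋎ (z ⋏ F)))

-- FSCL derivations take place in the joint signature, where the SCL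
-- operations are extra symbols constrained only by Defining below.
data CondOp (A : Set a) : Set a where
  scl  : SCLOp A → CondOp A
  cond : CondOp A

condArity : {A : Set a} → CondOp A → ℕ
condArity (scl f) = sclArity f
condArity cond    = 3

SCLCond : Set a → Signature a
SCLCond A = record { Op = CondOp A ; arity = condArity }

mutual
  embed : {A : Set a} → Term (SCL A) → Term (SCLCond A)
  embed (var i)   = var i
  embed (op f ts) = op (scl f) (embed* ts)

  embed* : {A : Set a} {n : ℕ} →
           Vec (Term (SCL A)) n → Vec (Term (SCLCond A)) n
  embed* []       = []
  embed* (t ∷ ts) = embed t ∷ embed* ts

module CondSyntax where
  infix  8 ¬_
  infixr 7 _⋏_
  infixr 6 _⋎_
  infix  5 _◁_▷_

  pattern T           = op (scl true) []
  pattern F           = op (scl false) []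
  pattern ¬_ s        = op (scl not) (s ∷ [])
  pattern _⋏_ s t     = op (scl and) (s ∷ t ∷ [])
  pattern _⋎_ s t     = op (scl or) (s ∷ t ∷ [])
  -- r ◁ s ▷ t : if s then r else t
  pattern _◁_▷_ r s t = op cond (r ∷ s ∷ t ∷ [])

module _ where
  open CondSyntax

  data CP (A : Set a) : Rel (Term (SCLCond A)) a where
    CP1 : CP A (x ◁ T ▷ y) x
    CP2 : CP A (x ◁ F ▷ y) y
    CP3 : CP A (T ◁ x ▷ F) x
    CP4 : CP A (x ◁ (y ◁ z ▷ u) ▷ v) ((x ◁ y ▷ v) ◁ z ▷ (x ◁ u ▷ v))

  data Defining (A : Set a) : Rel (Term (SCLCond A)) a where
    def-¬ : Defining A (¬ x) (F ◁ x ▷ T)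
    def-⋏ : Defining A (x ⋏ y) (y ◁ x ▷ F)
    def-⋎ : Defining A (x ⋎ y) (¬ (¬ x ⋏ ¬ y))

FSCL : (A : Set a) → Rel (Term (SCLCond A)) a
FSCL A = CP A ∪ Defining A

module Submission where

-- A closed term is determined by its evaluation tree: both systems are sound for trees,
-- every closed term is EqFSCL-provably equal to a normal form (a binary tree of atoms that
-- are evaluated without effect on the result, followed by T, F or a star), and a normal
-- form can be read off its tree. For the last point, all leaves T of the tree of x ⋏ y lie
-- in copies of the tree of y. Two decompositions as conjunctions therefore have nested
-- copies and, when the last factor is not itself a conjunction, the copies coincide. A
-- decomposition as a conjunction and one as a disjunction would each have strictly smaller
-- copies than the other.

open import Defs
open SCLSyntax
open import Data.Bool.Base using (Bool; true; false) renaming (not to opposite)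
open import Data.Bool.Properties using (_≟_; not-¬)
open import Data.Empty using (⊥-elim)
open import Data.Nat.Base using (ℕ; suc; _+_; _≤_; _<_; s≤s)
open import Data.Nat.Properties
  using (≤-refl; ≤-trans; ≤-total; <-asym; <-irrefl; <⇒≤; <⇒≱; m≤m+n; m≤n+m)
open import Data.Product.Base using (∃; _×_; _,_; proj₁; proj₂)
open import Data.Sum.Base using (_⊎_; inj₁; inj₂)
open import Data.Vec.Base using (Vec; []; _∷_)
open import Data.Vec.Relation.Binary.Pointwise.Inductive using (Pointwise; []; _∷_)
open import Data.Vec.Relation.Unary.All using ([]; _∷_)
open import Function.Base using (_∘_)
open import Function.Bundles using (_↣_)
open import Level using (Level)
open import Relation.Binary.Bundles using (Setoid)
open import Relation.Binary.Core using (Rel)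
open import Relation.Binary.PropositionalEquality as ≡ using (_≡_; _≢_; refl)
open import Relation.Nullary using (yes; no; contradiction)
import Relation.Binary.Reasoning.Setoid as SetoidReasoning

private variable
  a : Level
  A : Set a
  b c : Bool

-- Evaluation trees

data Tree (A : Set a) : Set a where
  leaf : Bool → Tree A
  node : A → (l r : Tree A) → Tree A

private variable
  D H K X Y Z : Tree A

node-injective : ∀ {i j : A} → node i X Y ≡ node j Z D → i ≡ j × X ≡ Z × Y ≡ D
node-injective refl = refl , refl , refl

choose : Tree A → Tree A → Bool → Tree A
choose X Y true  = X
choose X Y false = Y

bind : Tree A → (Bool → Tree A) → Tree A
bind (leaf e)     k = k e
bind (node i l r) k = node i (bind l k) (bind r k)

at : Bool → Tree A → Bool → Tree A
at true  Y = choose Y (leaf false)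
at false Y = choose (leaf true) Y

-- plug true and plug false are the left-sequential conjunction and disjunction of trees.
plug : Bool → Tree A → Tree A → Tree A
plug b X Y = bind X (at b Y)

at-same : ∀ b → at b Y b ≡ Y
at-same true  = refl
at-same false = refl

at-other : ∀ {e} → b ≢ e → at b Y e ≡ leaf e
at-other {true}  {e = true}  b≢e = contradiction refl b≢e
at-other {true}  {e = false} b≢e = refl
at-other {false} {e = true}  b≢e = refl
at-other {false} {e = false} b≢e = contradiction refl b≢e

bind-assoc : ∀ (X : Tree A) {k k'} → bind (bind X k) k' ≡ bind X (λ e → bind (k e) k')
bind-assoc (leaf e)     = refl
bind-assoc (node i l r) = ≡.cong₂ (node i) (bind-assoc l) (bind-assoc r)

bind-cong : ∀ (X : Tree A) {k k'} → (∀ e → k e ≡ k' e) → bind X k ≡ bind X k'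
bind-cong (leaf e)     eq = eq e
bind-cong (node i l r) eq = ≡.cong₂ (node i) (bind-cong l eq) (bind-cong r eq)

bind-identity : ∀ (X : Tree A) → bind X leaf ≡ X
bind-identity (leaf e)     = refl
bind-identity (node i l r) = ≡.cong₂ (node i) (bind-identity l) (bind-identity r)

bind-bind : ∀ (X : Tree A) {k k' k″} → (∀ e → bind (k e) k' ≡ k″ e) →
            bind (bind X k) k' ≡ bind X k″
bind-bind X eq = ≡.trans (bind-assoc X) (bind-cong X eq)

plug-assoc : ∀ b (X : Tree A) → plug b (plug b X Y) Z ≡ plug b X (plug b Y Z)
plug-assoc true  X = bind-bind X λ { true → refl ; false → refl }
plug-assoc false X = bind-bind X λ { true → refl ; false → refl }

-- Leaf labels, sizes and decompositions of trees by `plug`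

data Has {A : Set a} (b : Bool) : Tree A → Set a where
  here  : Has b (leaf b)
  left  : ∀ {i l r} → Has b l → Has b (node i l r)
  right : ∀ {i l r} → Has b r → Has b (node i l r)

Mixed : {A : Set a} → Tree A → Set a
Mixed X = ∀ b → Has b X

has-leaf : ∀ {e} → Has {A = A} b (leaf e) → b ≡ e
has-leaf here = refl

-- Leaves of `X` other than `b` keep their label, so a leaf `b` of the result lies in a copy of `Y`,
-- and that copy replaced a leaf `b` of `X`.
has-plug⁻ : ∀ b (X : Tree A) → Has b (plug b X Y) → Has b X
has-plug⁻ b (leaf e) h with b ≟ e
... | yes refl = here
... | no  b≢e  = contradiction (has-leaf (≡.subst (Has b) (at-other b≢e) h)) b≢e
has-plug⁻ b (node i l r) (left h)  = left (has-plug⁻ b l h)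
has-plug⁻ b (node i l r) (right h) = right (has-plug⁻ b r h)

has-plug : Has b X → Has c Y → Has c (plug b X Y)
has-plug {b = b} here h = ≡.subst (Has _) (≡.sym (at-same b)) h
has-plug (left p)  h = left (has-plug p h)
has-plug (right p) h = right (has-plug p h)

has-plug-other : b ≢ c → Has c X → Has c (plug b X Y)
has-plug-other b≢c here      = ≡.subst (Has _) (≡.sym (at-other b≢c)) here
has-plug-other b≢c (left h)  = left (has-plug-other b≢c h)
has-plug-other b≢c (right h) = right (has-plug-other b≢c h)

size : Tree A → ℕ
size (leaf e)     = 0
size (node i l r) = suc (size l + size r)

size-plug : Has b X → size Y ≤ size (plug b X Y)
size-plug {b = b} {Y = Y} here rewrite at-same {Y = Y} b = ≤-refl
size-plug (left h)  = ≤-trans (size-plug h) (≤-trans (m≤m+n _ _) (m≤n+m _ 1))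
size-plug (right h) = ≤-trans (size-plug h) (≤-trans (m≤n+m _ _) (m≤n+m _ 1))

-- The leaf `b` of `K` lies in a copy of `Z` that starts strictly below the root.
plug-node-smaller : ∀ (i : A) l r → Has b K → K ≡ plug b (node i l r) Z → size Z < size K
plug-node-smaller {b = b} i l r h refl with has-plug⁻ b (node i l r) h
... | left p  = s≤s (≤-trans (size-plug p) (m≤m+n _ _))
... | right p = s≤s (≤-trans (size-plug p) (m≤n+m _ _))

-- Descend in both heads at once. If just one of them stops, at a leaf `b`, then `D` would be a
-- proper part of itself. The leaf `b` of `D` also prevents `D` from being the other constant, which
-- would make the two leaf heads indistinguishable.
plug-cancelʳ : ∀ X Y → Has b D → plug b X D ≡ plug b Y D → X ≡ Y
plug-cancelʳ {b = b} {D = D} (leaf d) (leaf e) h eq with b ≟ d | b ≟ e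
... | yes refl | yes refl = refl
... | yes refl | no b≢e rewrite at-same {Y = D} b | at-other {Y = D} b≢e | eq =
  contradiction (has-leaf h) b≢e
... | no b≢d | yes refl rewrite at-same {Y = D} b | at-other {Y = D} b≢d | ≡.sym eq =
  contradiction (has-leaf h) b≢d
... | no b≢d | no b≢e = ≡.trans (≡.sym (at-other b≢d)) (≡.trans eq (at-other b≢e))
plug-cancelʳ {b = b} {D = D} (leaf d) (node i l r) h eq with b ≟ d
... | yes refl rewrite at-same {Y = D} b = contradiction (plug-node-smaller i l r h eq) (<-irrefl refl)
... | no b≢d rewrite at-other {Y = D} b≢d with () ← eq
plug-cancelʳ {b = b} {D = D} (node i l r) (leaf e) h eq with b ≟ e
... | yes refl rewrite at-same {Y = D} b =
  contradiction (plug-node-smaller i l r h (≡.sym eq)) (<-irrefl refl)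
... | no b≢e rewrite at-other {Y = D} b≢e with () ← eq
plug-cancelʳ (node i l r) (node j l' r') h eq with refl , p , q ← node-injective eq =
  ≡.cong₂ (node i) (plug-cancelʳ l l' h p) (plug-cancelʳ r r' h q)

private
  -- Follow the given path in `X` to a leaf `b`, where a copy of `D` starts. By `factor-node`, `X'`
  -- cannot stop earlier: a copy of `D'` starting there would be larger than `D`. What is left of
  -- `X'` at the end of the path is `H`.
  factor : Has b X → ∀ X' {D D' : Tree A} → Has b D' → size D' ≤ size D →
           plug b X D ≡ plug b X' D' → ∃ λ H → D ≡ plug b H D'
  factor-node : ∀ {i : A} {l r : Tree A} → Has b (node i l r) → ∀ e {D D'} →
                Has b D' → size D' ≤ size D → plug b (node i l r) D ≢ plug b (leaf e) D'

  factor {b = b} here X' hD' D'≤D eq = X' , ≡.trans (≡.sym (at-same b)) eq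
  factor h@(left _)  (leaf e) hD' D'≤D eq = ⊥-elim (factor-node h e hD' D'≤D eq)
  factor h@(right _) (leaf e) hD' D'≤D eq = ⊥-elim (factor-node h e hD' D'≤D eq)
  factor (left h)  (node _ l _) hD' D'≤D eq = factor h l hD' D'≤D (proj₁ (proj₂ (node-injective eq)))
  factor (right h) (node _ _ r) hD' D'≤D eq = factor h r hD' D'≤D (proj₂ (proj₂ (node-injective eq)))

  factor-node {b = b} {i = i} {l} {r} h e {D' = D'} hD' D'≤D eq with b ≟ e
  ... | yes refl rewrite at-same {Y = D'} b = <⇒≱ (plug-node-smaller i l r hD' (≡.sym eq)) D'≤D
  ... | no b≢e rewrite at-other {Y = D'} b≢e with () ← eq

-- Levi's lemma for plug: every leaf b of the common tree lies in a copy of D and in a copy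
-- of D', so these copies are nested.
plug-levi : ∀ X X' {D D' : Tree A} → Has b X → Has b D' → size D' ≤ size D →
            plug b X D ≡ plug b X' D' → ∃ λ H → D ≡ plug b H D' × X' ≡ plug b X H
plug-levi {b = b} X X' h hD' D'≤D eq with H , refl ← factor h X' hD' D'≤D eq =
  H , refl , plug-cancelʳ X' (plug b X H) hD' (≡.trans (≡.sym eq) (≡.sym (plug-assoc b X)))

-- A leaf c of X lies outside every copy of D, hence in a copy of Y; as that copy also
-- has a leaf b, it strictly contains a copy of D.
plug-clash-< : b ≢ c → ∀ X Z {D Y : Tree A} → Has c X → Has b Y →
               plug b X D ≡ plug c Z Y → size D < size Y
plug-clash-< {b = b} {c} b≢c (leaf _) (leaf e) {D} {Y} here hY eq
  rewrite at-other {Y = D} b≢c with c ≟ e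
... | no c≢e rewrite at-other {Y = Y} c≢e with refl ← eq = contradiction refl c≢e
... | yes refl rewrite at-same {Y = Y} c | ≡.sym eq = contradiction (has-leaf hY) b≢c
plug-clash-< b≢c (leaf _) (node _ _ _) {D} here hY eq rewrite at-other {Y = D} b≢c with () ← eq
plug-clash-< {c = c} b≢c (node i l r) (leaf e) {D} {Y} h hY eq with c ≟ e
... | no c≢e rewrite at-other {Y = Y} c≢e with () ← eq
... | yes refl rewrite at-same {Y = Y} c = plug-node-smaller i l r hY (≡.sym eq)
plug-clash-< b≢c (node _ l _) (node _ l' _) (left h)  hY eq =
  plug-clash-< b≢c l l' h hY (proj₁ (proj₂ (node-injective eq)))
plug-clash-< b≢c (node _ _ r) (node _ _ r') (right h) hY eq =
  plug-clash-< b≢c r r' h hY (proj₂ (proj₂ (node-injective eq)))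

plug-clash : b ≢ c → ∀ X Z {D Y : Tree A} → Has c X → Has b Z → Has c D → Has b Y →
             plug b X D ≢ plug c Z Y
plug-clash b≢c X Z hX hZ hD hY eq =
  <-asym (plug-clash-< b≢c X Z hX hY eq)
         (plug-clash-< (b≢c ∘ ≡.sym) Z X hZ hD (≡.sym eq))

-- Normal forms

data Shape (A : Set a) : Set a where
  end  : Shape A
  node : A → (s t : Shape A) → Shape A

-- A literal evaluates an atom and then runs a shape before each exit: the first shape
-- before the exit T, the second before the exit F. A Star b is not a (opposite b)-join.
data Star (A : Set a) : Bool → Set a where
  lit  : (sign : Bool) → A → (s t : Shape A) → Star A b
  join : ∀ b {c} → Star A c → Star A (opposite b) → Star A b

data Core (A : Set a) : Set a where
  con  : Bool → Core A
  star : Star A b → Core A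

record NF (A : Set a) : Set a where
  constructor _∙_
  field
    prefix : Shape A
    core   : Core A

graft : Shape A → Tree A → Tree A
graft end          Y = Y
graft (node i s t) Y = node i (graft s Y) (graft t Y)

fill : Shape A → Bool → Tree A
fill s b = graft s (leaf b)

starTree : Star A b → Tree A
starTree (lit true  i s t) = node i (fill s true) (fill t false)
starTree (lit false i s t) = node i (fill t false) (fill s true)
starTree (join b x y)      = plug b (starTree x) (starTree y)

coreTree : Core A → Tree A
coreTree (con b)  = leaf b
coreTree (star x) = starTree x

nfTree : NF A → Tree A
nfTree (s ∙ x) = graft s (coreTree x)

-- Since `shapeTerm s` only yields `T`, the disjunct `shapeTerm t` is evaluated exactly when the
-- atom yields `F`.
shapeTerm : Shape A → Term (SCL A)
shapeTerm end          = T
shapeTerm (node i s t) = (op (atom i) [] ⋏ shapeTerm s) ⋎ shapeTerm t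

literal : Bool → A → Term (SCL A)
literal true  i = op (atom i) []
literal false i = ¬ op (atom i) []

connective : Bool → Term (SCL A) → Term (SCL A) → Term (SCL A)
connective true  x y = x ⋏ y
connective false x y = x ⋎ y

constant : Bool → Term (SCL A)
constant true  = T
constant false = F

-- The trailing `⋏ F` keeps the result `F` after the second shape has run, and gives a literal the
-- form to which `SCL10` applies.
starTerm : Star A b → Term (SCL A)
starTerm (lit b i s t) = (literal b i ⋏ shapeTerm s) ⋎ (shapeTerm t ⋏ F)
starTerm (join b x y)  = connective b (starTerm x) (starTerm y)

coreTerm : Core A → Term (SCL A)
coreTerm (con b)  = constant b
coreTerm (star x) = starTerm x

nfTerm : NF A → Term (SCL A)
nfTerm (s ∙ x) = shapeTerm s ⋏ coreTerm x

-- Injectivity of the tree of a normal form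

has-graft : ∀ (s : Shape A) → Has b Y → Has b (graft s Y)
has-graft end          h = h
has-graft (node _ s t) h = left (has-graft s h)

has-graft⁻ : ∀ (s : Shape A) → Has b (graft s Y) → Has b Y
has-graft⁻ end          h         = h
has-graft⁻ (node _ s t) (left h)  = has-graft⁻ s h
has-graft⁻ (node _ s t) (right h) = has-graft⁻ t h

fill-not-mixed : ∀ (s : Shape A) → Mixed X → X ≢ fill s b
fill-not-mixed {b = b} s m refl = not-¬ {b} refl (≡.sym (has-leaf (has-graft⁻ s (m (opposite b)))))

plug-graft : ∀ b (s : Shape A) → plug b (graft s X) Y ≡ graft s (plug b X Y)
plug-graft b end          = refl
plug-graft b (node i s t) = ≡.cong₂ (node i) (plug-graft b s) (plug-graft b t)

plug-fill : ∀ b (s : Shape A) → plug b (fill s b) Y ≡ graft s Y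
plug-fill b s = ≡.trans (plug-graft b s) (≡.cong (graft s) (at-same b))

fill-injective : ∀ (s t : Shape A) → fill s b ≡ fill t c → s ≡ t × b ≡ c
fill-injective end end refl = refl , refl
fill-injective (node i s t) (node j s' t') eq with refl , p , q ← node-injective eq
  with refl , e ← fill-injective s s' p | refl , _ ← fill-injective t t' q = refl , e

-- Allows a head without a leaf `c` to be treated as a shape, so that `plug b` becomes `graft`.
has-or-fill : ∀ {b c} → b ≢ c → (X : Tree A) → Has c X ⊎ ∃ λ s → X ≡ fill s b
has-or-fill {b = true}  {true}  b≢c X = contradiction refl b≢c
has-or-fill {b = false} {false} b≢c X = contradiction refl b≢c
has-or-fill {b = true}  {false} b≢c (leaf true)  = inj₂ (end , refl)
has-or-fill {b = true}  {false} b≢c (leaf false) = inj₁ here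
has-or-fill {b = false} {true}  b≢c (leaf true)  = inj₁ here
has-or-fill {b = false} {true}  b≢c (leaf false) = inj₂ (end , refl)
has-or-fill {b = true}  {false} b≢c (node i l r) with has-or-fill b≢c l | has-or-fill b≢c r
... | inj₁ h | _ = inj₁ (left h)
... | _ | inj₁ h = inj₁ (right h)
... | inj₂ (s , refl) | inj₂ (t , refl) = inj₂ (node i s t , refl)
has-or-fill {b = false} {true}  b≢c (node i l r) with has-or-fill b≢c l | has-or-fill b≢c r
... | inj₁ h | _ = inj₁ (left h)
... | _ | inj₁ h = inj₁ (right h)
... | inj₂ (s , refl) | inj₂ (t , refl) = inj₂ (node i s t , refl)

≢-opposite : ∀ b → b ≢ opposite b
≢-opposite b = not-¬ refl

star-mixed : (x : Star A b) → Mixed (starTree x)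
star-mixed (lit true  i s t) true  = left (has-graft s here)
star-mixed (lit true  i s t) false = right (has-graft t here)
star-mixed (lit false i s t) true  = right (has-graft s here)
star-mixed (lit false i s t) false = left (has-graft t here)
star-mixed (join b x y) c with b ≟ c
... | yes refl = has-plug {b = b} (star-mixed x b) (star-mixed y b)
... | no  b≢c  = has-plug-other b≢c (star-mixed x c)

-- Each branch of a literal carries a single leaf label, but one of the branches would contain a
-- whole copy of the mixed tree `Y`.
lit-irreducible : ∀ {i j : A} s t {d e l r} → Has b (node j l r) → Mixed Y →
                  node i (fill s d) (fill t e) ≢ plug b (node j l r) Y
lit-irreducible s t (left h)  m eq =
  fill-not-mixed s (λ c → has-plug h (m c)) (≡.sym (proj₁ (proj₂ (node-injective eq))))
lit-irreducible s t (right h) m eq =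
  fill-not-mixed t (λ c → has-plug h (m c)) (≡.sym (proj₂ (proj₂ (node-injective eq))))

-- This separates the prefix of a normal form from its core. A literal has no mixed branch; for a
-- join, the prefix would already be a prefix of the first factor, which induction excludes.
star-prefix-free : ∀ (x : Star A b) {i s t} → Mixed Y → starTree x ≢ graft (node i s t) Y
star-prefix-free (lit true  _ s _) {s = s'} m eq =
  fill-not-mixed s (λ c → has-graft s' (m c)) (≡.sym (proj₁ (proj₂ (node-injective eq))))
star-prefix-free (lit false _ _ t) {s = s'} m eq =
  fill-not-mixed t (λ c → has-graft s' (m c)) (≡.sym (proj₁ (proj₂ (node-injective eq))))
star-prefix-free {Y = Y} (join b x y) {i} {s} {t} m eq =
  -- `graft S Y` is read as a `b`-plug with head `fill S b`. As `Y` is the larger copy, Levi's lemma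
  -- makes `starTree x` equal to `graft S H`, and `H` inherits mixedness from `x`.
  let H , _ , x≡ = plug-levi (fill S b) (starTree x) (has-graft S here) (star-mixed y b)
                             (<⇒≤ y<Y) (≡.trans (plug-fill b S) (≡.sym eq))
      x≡S = ≡.trans x≡ (plug-fill b S)
  in star-prefix-free x (λ c → has-graft⁻ S (≡.subst (Has c) x≡S (star-mixed x c))) x≡S
  where
  S = node i s t
  y<Y : size (starTree y) < size Y
  -- The label filled into `S` is free, so the same graft is also an `opposite b`-plug, and the
  -- comparison of clashing decompositions applies.
  y<Y = plug-clash-< (≢-opposite b) (starTree x) (fill S (opposite b))
          (star-mixed x (opposite b)) (m b) (≡.trans eq (≡.sym (plug-fill (opposite b) S)))

-- A head with only leaves `b` is a shape, excluded by `star-prefix-free` unless it is trivial. For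
-- any other head, `x` is a join of the opposite connective, excluded by `plug-clash`, or a literal,
-- excluded by `lit-irreducible`.
star-irreducible : ∀ {b} (x : Star A (opposite b)) → ∀ H → Mixed Y →
                   starTree x ≡ plug b H Y → H ≡ leaf b
star-irreducible {b = b} x (leaf e) m eq with b ≟ e
... | yes refl = refl
... | no b≢e   = contradiction (≡.trans eq (at-other b≢e)) (fill-not-mixed end (star-mixed x))
star-irreducible {b = b} x H@(node _ _ _) m eq with has-or-fill (≢-opposite b) H
... | inj₂ (s@(node _ _ _) , refl) =
  contradiction (≡.trans eq (plug-fill b s)) (star-prefix-free x m)
... | inj₁ h with x
... | join _ y z =
  contradiction (≡.sym eq)
    (plug-clash (≢-opposite b) H (starTree y) h (star-mixed y b) (m (opposite b)) (star-mixed z b))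
... | lit true i s t =
  ⊥-elim (lit-irreducible s t
    (has-plug⁻ b H (≡.subst (Has b) eq (star-mixed {b = b} (lit true i s t) b))) m eq)
... | lit false i s t =
  ⊥-elim (lit-irreducible t s
    (has-plug⁻ b H (≡.subst (Has b) eq (star-mixed {b = b} (lit false i s t) b))) m eq)

-- The size hypothesis says which copies are nested in which. Levi's lemma writes `y` as a plug
-- ending in `y'`, and irreducibility of `y` makes the extra head trivial.
join-injective : ∀ b {c d} (x : Star A c) (y : Star A (opposite b))
                 (x' : Star A d) (y' : Star A (opposite b)) →
                 size (starTree y') ≤ size (starTree y) →
                 starTree (join b x y) ≡ starTree (join b x' y') →
                 starTree x' ≡ starTree x × starTree y ≡ starTree y'
join-injective b x y x' y' le eq
  with H , y≡ , x'≡ ← plug-levi (starTree x) (starTree x') (star-mixed x b) (star-mixed y' b) le eq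
  with refl ← star-irreducible y H (star-mixed y') y≡ =
  plug-cancelʳ (starTree x') (starTree x) (star-mixed y b)
    (≡.trans (≡.cong (plug b (starTree x')) y≡y') (≡.sym eq)) , y≡y'
  where y≡y' = ≡.trans y≡ (at-same b)

lit≢join : ∀ d (i : A) s t b {c} (x : Star A c) (y : Star A (opposite b)) →
           starTree (lit {b = true} d i s t) ≢ starTree (join b x y)
-- The split exposes the root node that `lit-irreducible` asks for.
lit≢join d i s t b x y eq with starTree x in x≡
... | leaf e = fill-not-mixed end (star-mixed x) x≡
lit≢join true i s t b x y eq | node _ _ _ =
  lit-irreducible s t (≡.subst (Has b) x≡ (star-mixed x b)) (star-mixed y) eq
lit≢join false i s t b x y eq | node _ _ _ =
  lit-irreducible t s (≡.subst (Has b) x≡ (star-mixed x b)) (star-mixed y) eq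

-- The conclusion is about terms because a literal inhabits `Star A b` for either `b`: stars with
-- the same tree may have different types.
star-injective : (x : Star A b) (y : Star A c) → starTree x ≡ starTree y → starTerm x ≡ starTerm y
star-injective (lit true i s t) (lit true j s' t') eq with refl , p , q ← node-injective eq
  with refl , _ ← fill-injective s s' p | refl , _ ← fill-injective t t' q = refl
star-injective (lit false i s t) (lit false j s' t') eq with refl , p , q ← node-injective eq
  with refl , _ ← fill-injective t t' p | refl , _ ← fill-injective s s' q = refl
star-injective (lit true i s t) (lit false j s' t') eq
  with () ← proj₂ (fill-injective s t' (proj₁ (proj₂ (node-injective eq))))
star-injective (lit false i s t) (lit true j s' t') eq
  with () ← proj₂ (fill-injective t s' (proj₁ (proj₂ (node-injective eq))))
star-injective (lit true  i s t) (join b x y) eq = ⊥-elim (lit≢join true  i s t b x y eq)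
star-injective (lit false i s t) (join b x y) eq = ⊥-elim (lit≢join false i s t b x y eq)
star-injective (join b x y) (lit true  i s t) eq = ⊥-elim (lit≢join true  i s t b x y (≡.sym eq))
star-injective (join b x y) (lit false i s t) eq = ⊥-elim (lit≢join false i s t b x y (≡.sym eq))
star-injective (join b x y) (join c x' y') eq with b ≟ c
... | no b≢c = contradiction eq
  (plug-clash b≢c (starTree x) (starTree x')
    (star-mixed x c) (star-mixed x' b) (star-mixed y c) (star-mixed y' b))
... | yes refl with ≤-total (size (starTree y')) (size (starTree y))
... | inj₁ le with p , q ← join-injective b x y x' y' le eq =
  ≡.cong₂ (connective b) (star-injective x x' (≡.sym p)) (star-injective y y' q)
... | inj₂ le with p , q ← join-injective b x' y' x y le (≡.sym eq) =
  ≡.cong₂ (connective b) (star-injective x x' p) (star-injective y y' (≡.sym q))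

core-prefix-free : ∀ (x y : Core A) {i s t} → coreTree x ≢ graft (node i s t) (coreTree y)
core-prefix-free (star x) (con b)  eq = fill-not-mixed (node _ _ _) (star-mixed x) eq
core-prefix-free (star x) (star y) eq = star-prefix-free x (star-mixed y) eq

core-injective : (x y : Core A) → coreTree x ≡ coreTree y → coreTerm x ≡ coreTerm y
core-injective (con b)  (con _)  refl = refl
core-injective (con b)  (star y) eq   = ⊥-elim (fill-not-mixed end (star-mixed y) (≡.sym eq))
core-injective (star x) (con c)  eq   = ⊥-elim (fill-not-mixed end (star-mixed x) eq)
core-injective (star x) (star y) eq   = star-injective x y eq

graft-core-injective : ∀ s t (x y : Core A) → graft s (coreTree x) ≡ graft t (coreTree y) →
                       s ≡ t × coreTree x ≡ coreTree y
graft-core-injective end end x y eq = refl , eq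
graft-core-injective end (node _ _ _) x y eq = ⊥-elim (core-prefix-free x y eq)
graft-core-injective (node _ _ _) end x y eq = ⊥-elim (core-prefix-free y x (≡.sym eq))
graft-core-injective (node i s t) (node j s' t') x y eq with refl , p , q ← node-injective eq
  with refl , e ← graft-core-injective s s' x y p | refl , _ ← graft-core-injective t t' x y q =
  refl , e

nf-injective : (m n : NF A) → nfTree m ≡ nfTree n → nfTerm m ≡ nfTerm n
nf-injective (s ∙ x) (t ∙ y) eq with refl , e ← graft-core-injective s t x y eq =
  ≡.cong (λ u → shapeTerm s ⋏ u) (core-injective x y e)

-- Soundness of both systems for evaluation trees

module Interpretation {S : Signature a} {B : Set a} (⟦_⟧ : (f : Op S) → Vec B (arity S f) → B) where

  Valuation : Set _
  Valuation = ℕ → B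

  mutual
    eval : Valuation → Term S → B
    eval ρ (var i)   = ρ i
    eval ρ (op f ts) = ⟦ f ⟧ (eval* ρ ts)

    eval* : ∀ {n} → Valuation → Vec (Term S) n → Vec B n
    eval* ρ []       = []
    eval* ρ (t ∷ ts) = eval ρ t ∷ eval* ρ ts

  mutual
    eval-[] : ∀ ρ σ t → eval ρ (t [ σ ]) ≡ eval (eval ρ ∘ σ) t
    eval-[] ρ σ (var i)   = refl
    eval-[] ρ σ (op f ts) = ≡.cong ⟦ f ⟧ (eval*-[] ρ σ ts)

    eval*-[] : ∀ {n} ρ σ (ts : Vec (Term S) n) → eval* ρ (ts [ σ ]*) ≡ eval* (eval ρ ∘ σ) ts
    eval*-[] ρ σ []       = refl
    eval*-[] ρ σ (t ∷ ts) = ≡.cong₂ _∷_ (eval-[] ρ σ t) (eval*-[] ρ σ ts)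

  module _ {E : Rel (Term S) a} (valid : ∀ {s t} → E s t → ∀ ρ → eval ρ s ≡ eval ρ t) where
    mutual
      sound : ∀ {s t} → E ⊢ s ≈ t → ∀ ρ → eval ρ s ≡ eval ρ t
      sound (axiom e)            ρ = valid e ρ
      sound refl                 ρ = refl
      sound (sym p)              ρ = ≡.sym (sound p ρ)
      sound (trans p q)          ρ = ≡.trans (sound p ρ) (sound q ρ)
      sound (cong {f} ps)        ρ = ≡.cong ⟦ f ⟧ (sound* ps ρ)
      sound (subst {s} {t} σ p)  ρ = ≡.trans (eval-[] ρ σ s)
        (≡.trans (sound p (eval ρ ∘ σ)) (≡.sym (eval-[] ρ σ t)))

      sound* : ∀ {n} {ss ts : Vec (Term S) n} → Pointwise (E ⊢_≈_) ss ts → ∀ ρ → eval* ρ ss ≡ eval* ρ ts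
      sound* []       ρ = refl
      sound* (p ∷ ps) ρ = ≡.cong₂ _∷_ (sound p ρ) (sound* ps ρ)

infix 5 _◁_▷_
_◁_▷_ : Tree A → Tree A → Tree A → Tree A
X ◁ Y ▷ Z = bind Y (choose X Z)

tt ff : Tree A
tt = leaf true
ff = leaf false

treeSCL : (f : SCLOp A) → Vec (Tree A) (sclArity f) → Tree A
treeSCL true     []          = tt
treeSCL false    []          = ff
treeSCL (atom i) []          = node i tt ff
treeSCL not      (X ∷ [])     = ff ◁ X ▷ tt
treeSCL and      (X ∷ Y ∷ []) = plug true X Y
treeSCL or       (X ∷ Y ∷ []) = plug false X Y

treeCond : (f : CondOp A) → Vec (Tree A) (condArity f) → Tree A
treeCond (scl f) Xs               = treeSCL f Xs
treeCond cond    (X ∷ Y ∷ Z ∷ []) = X ◁ Y ▷ Z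

module TreeSCL {a} {A : Set a} = Interpretation (treeSCL {A = A})
module TreeCond {a} {A : Set a} = Interpretation (treeCond {A = A})

-- The default `tt` for variables never enters the final comparison, which concerns closed terms and
-- normal forms.
tree : Term (SCL A) → Tree A
tree = TreeSCL.eval (λ _ → tt)

mutual
  eval-embed : ∀ ρ (t : Term (SCL A)) → TreeCond.eval ρ (embed t) ≡ TreeSCL.eval ρ t
  eval-embed ρ (var i)   = refl
  eval-embed ρ (op f ts) = ≡.cong (treeSCL f) (eval-embed* ρ ts)

  eval-embed* : ∀ {n} ρ (ts : Vec (Term (SCL A)) n) → TreeCond.eval* ρ (embed* ts) ≡ TreeSCL.eval* ρ ts
  eval-embed* ρ []       = refl
  eval-embed* ρ (t ∷ ts) = ≡.cong₂ _∷_ (eval-embed ρ t) (eval-embed* ρ ts)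

◁▷-identity : (X : Tree A) → (tt ◁ X ▷ ff) ≡ X
◁▷-identity X = ≡.trans (bind-cong X λ { true → refl ; false → refl }) (bind-identity X)

-- Axiom `CP4` is associativity of `bind`.
◁▷-assoc : (X Y Z U V : Tree A) → (X ◁ (Y ◁ Z ▷ U) ▷ V) ≡ ((X ◁ Y ▷ V) ◁ Z ▷ (X ◁ U ▷ V))
◁▷-assoc X Y Z U V = bind-bind Z λ { true → refl ; false → refl }

¬-involutive : (X : Tree A) → (ff ◁ (ff ◁ X ▷ tt) ▷ tt) ≡ X
¬-involutive X = ≡.trans (◁▷-assoc ff ff X tt tt) (◁▷-identity X)

deMorgan : (X Y : Tree A) → plug false X Y ≡ (ff ◁ plug true (ff ◁ X ▷ tt) (ff ◁ Y ▷ tt) ▷ tt)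
deMorgan X Y = ≡.sym (≡.trans (≡.cong (λ U → ff ◁ U ▷ tt) (◁▷-assoc (ff ◁ Y ▷ tt) ff X tt ff))
  (bind-bind X λ { true → refl ; false → ¬-involutive Y }))

FSCL-valid : ∀ {s t} → FSCL A s t → ∀ ρ → TreeCond.eval ρ s ≡ TreeCond.eval ρ t
FSCL-valid (inj₁ CP1)   ρ = refl
FSCL-valid (inj₁ CP2)   ρ = refl
FSCL-valid (inj₁ CP3)   ρ = ◁▷-identity (ρ 0)
FSCL-valid (inj₁ CP4)   ρ = ◁▷-assoc (ρ 0) (ρ 1) (ρ 2) (ρ 3) (ρ 4)
FSCL-valid (inj₂ def-¬) ρ = refl
FSCL-valid (inj₂ def-⋏) ρ = refl
FSCL-valid (inj₂ def-⋎) ρ = deMorgan (ρ 0) (ρ 1)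

EqFSCL-valid : ∀ {s t} → EqFSCL A s t → ∀ ρ → TreeSCL.eval ρ s ≡ TreeSCL.eval ρ t
EqFSCL-valid SCL1 ρ = refl
EqFSCL-valid SCL2 ρ = deMorgan (ρ 0) (ρ 1)
EqFSCL-valid SCL3 ρ = ¬-involutive (ρ 0)
EqFSCL-valid SCL4 ρ = refl
EqFSCL-valid SCL5 ρ = ◁▷-identity (ρ 0)
EqFSCL-valid SCL6 ρ = refl
EqFSCL-valid SCL7 ρ = plug-assoc true (ρ 0)
EqFSCL-valid SCL8 ρ = ≡.sym (bind-bind (ρ 0) λ { true → refl ; false → refl })
-- Both sides run the first argument and continue with the second whatever the result.
EqFSCL-valid SCL9 ρ = ≡.trans (bind-bind (ρ 0) λ { true → refl ; false → refl })
  (≡.sym (bind-bind (ρ 0) {k″ = choose (ρ 1) (ρ 1)} λ { true → refl ; false → refl }))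
-- After `F` from the first argument both sides continue with `W`: on the right all leaves of `W`
-- are `F`, so the second conjunct is not entered.
EqFSCL-valid SCL10 ρ = ≡.trans
  (bind-bind (ρ 0) {k″ = choose (plug false (ρ 1) W) W} λ { true → refl ; false → refl })
  (≡.sym (bind-bind (ρ 0) λ
    { true  → refl
    ; false → bind-bind (ρ 2) λ { true → refl ; false → refl } }))
  where W = plug true (ρ 2) ff

tree-sound : {P Q : Term (SCL A)} → EqFSCL A ⊢ P ≈ Q → tree P ≡ tree Q
tree-sound p = TreeSCL.sound EqFSCL-valid p _

FSCL-tree-sound : (P Q : Term (SCL A)) → FSCL A ⊢ embed P ≈ embed Q → tree P ≡ tree Q
FSCL-tree-sound P Q p =
  ≡.trans (≡.sym (eval-embed _ P)) (≡.trans (TreeCond.sound FSCL-valid p _) (eval-embed _ Q))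

-- Evaluation trees of the normal-form terms

tree-shape : (s : Shape A) → tree (shapeTerm s) ≡ fill s true
tree-shape end = refl
tree-shape (node i s t) = ≡.cong₂ (node i)
  (≡.trans (≡.cong (λ X → plug false X _) (tree-shape s)) (plug-graft false s))
  (tree-shape t)

tree-prefix : ∀ (s : Shape A) x → tree (shapeTerm s ⋏ x) ≡ graft s (tree x)
tree-prefix s x = ≡.trans (≡.cong (λ X → plug true X (tree x)) (tree-shape s)) (plug-fill true s)

tree-star : (x : Star A b) → tree (starTerm x) ≡ starTree x
tree-star (lit true i s t) = ≡.cong₂ (node i)
  (≡.trans (≡.cong (λ X → plug false X _) (tree-shape s)) (plug-graft false s))
  (tree-prefix t F)
tree-star (lit false i s t) = ≡.cong₂ (node i)
  (tree-prefix t F)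
  (≡.trans (≡.cong (λ X → plug false X _) (tree-shape s)) (plug-graft false s))
tree-star (join true x y)  = ≡.cong₂ (plug true) (tree-star x) (tree-star y)
tree-star (join false x y) = ≡.cong₂ (plug false) (tree-star x) (tree-star y)

tree-core : (x : Core A) → tree (coreTerm x) ≡ coreTree x
tree-core (con true)  = refl
tree-core (con false) = refl
tree-core (star x)    = tree-star x

tree-nf : (n : NF A) → tree (nfTerm n) ≡ nfTree n
tree-nf (s ∙ x) = ≡.trans (tree-prefix s (coreTerm x)) (≡.cong (graft s) (tree-core x))

-- Normalisation in EqFSCL

module Derivation {a} (A : Set a) where

  infix 4 _≈_
  _≈_ : Rel (Term (SCL A)) a
  _≈_ = EqFSCL A ⊢_≈_

  setoid : Setoid a a
  setoid = record
    { Carrier       = Term (SCL A)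
    ; _≈_           = _≈_
    ; isEquivalence = record { refl = refl ; sym = sym ; trans = trans }
    }

  open SetoidReasoning setoid

  ¬-cong : ∀ {x y} → x ≈ y → ¬ x ≈ ¬ y
  ¬-cong p = cong (p ∷ [])

  ⋏-cong : ∀ {x x' y y'} → x ≈ x' → y ≈ y' → x ⋏ y ≈ x' ⋏ y'
  ⋏-cong p q = cong (p ∷ q ∷ [])

  ⋎-cong : ∀ {x x' y y'} → x ≈ x' → y ≈ y' → x ⋎ y ≈ x' ⋎ y'
  ⋎-cong p q = cong (p ∷ q ∷ [])

  ⟨_,_,_⟩ : (x y z : Term (SCL A)) → Substitution (SCL A)
  ⟨ x , y , z ⟩ 0 = x
  ⟨ x , y , z ⟩ 1 = y
  ⟨ x , y , z ⟩ _ = z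

  F≈¬T : F ≈ ¬ T
  F≈¬T = axiom SCL1

  ⋎-def : ∀ x y → x ⋎ y ≈ ¬ (¬ x ⋏ ¬ y)
  ⋎-def x y = subst ⟨ x , y , x ⟩ (axiom SCL2)

  ¬¬ : ∀ x → ¬ ¬ x ≈ x
  ¬¬ x = subst ⟨ x , x , x ⟩ (axiom SCL3)

  ⋏-identityˡ : ∀ x → T ⋏ x ≈ x
  ⋏-identityˡ x = subst ⟨ x , x , x ⟩ (axiom SCL4)

  ⋏-identityʳ : ∀ x → x ⋏ T ≈ x
  ⋏-identityʳ x = subst ⟨ x , x , x ⟩ (axiom SCL5)

  ⋏-zeroˡ : ∀ x → F ⋏ x ≈ F
  ⋏-zeroˡ x = subst ⟨ x , x , x ⟩ (axiom SCL6)

  ⋏-assoc : ∀ x y z → (x ⋏ y) ⋏ z ≈ x ⋏ (y ⋏ z)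
  ⋏-assoc x y z = subst ⟨ x , y , z ⟩ (axiom SCL7)

  ⋏F-¬ : ∀ x → x ⋏ F ≈ ¬ x ⋏ F
  ⋏F-¬ x = subst ⟨ x , x , x ⟩ (axiom SCL8)

  ⋏F-⋎ : ∀ x y → (x ⋏ F) ⋎ y ≈ (x ⋎ T) ⋏ y
  ⋏F-⋎ x y = subst ⟨ x , y , x ⟩ (axiom SCL9)

  ⋎-⋏F-distribʳ : ∀ x y z → (x ⋏ y) ⋎ (z ⋏ F) ≈ (x ⋎ (z ⋏ F)) ⋏ (y ⋎ (z ⋏ F))
  ⋎-⋏F-distribʳ x y z = subst ⟨ x , y , z ⟩ (axiom SCL10)

  -- Dual equations and terms with constant result

  ¬T≈F : ¬ T ≈ F
  ¬T≈F = sym F≈¬T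

  ¬F≈T : ¬ F ≈ T
  ¬F≈T = trans (¬-cong F≈¬T) (¬¬ T)

  ¬-⋏ : ∀ x y → ¬ (x ⋏ y) ≈ ¬ x ⋎ ¬ y
  ¬-⋏ x y = sym (trans (⋎-def (¬ x) (¬ y)) (¬-cong (⋏-cong (¬¬ x) (¬¬ y))))

  ¬-⋎ : ∀ x y → ¬ (x ⋎ y) ≈ ¬ x ⋏ ¬ y
  ¬-⋎ x y = trans (¬-cong (⋎-def x y)) (¬¬ _)

  -- The tool for duality: negating both sides turns a law of `⋎` into one of `⋏`.
  ¬-injective : ∀ {x y} → ¬ x ≈ ¬ y → x ≈ y
  ¬-injective p = trans (sym (¬¬ _)) (trans (¬-cong p) (¬¬ _))

  ⋎-identityˡ : ∀ x → F ⋎ x ≈ x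
  ⋎-identityˡ x = ¬-injective (trans (¬-⋎ F x) (trans (⋏-cong ¬F≈T refl) (⋏-identityˡ (¬ x))))

  ⋎-identityʳ : ∀ x → x ⋎ F ≈ x
  ⋎-identityʳ x = ¬-injective (trans (¬-⋎ x F) (trans (⋏-cong refl ¬F≈T) (⋏-identityʳ (¬ x))))

  ⋎-zeroˡ : ∀ x → T ⋎ x ≈ T
  ⋎-zeroˡ x = ¬-injective (begin
    ¬ (T ⋎ x)   ≈⟨ ¬-⋎ T x ⟩
    ¬ T ⋏ ¬ x   ≈⟨ ⋏-cong ¬T≈F refl ⟩
    F ⋏ ¬ x     ≈⟨ ⋏-zeroˡ (¬ x) ⟩
    F           ≈⟨ F≈¬T ⟩
    ¬ T         ∎)

  ⋎-assoc : ∀ x y z → (x ⋎ y) ⋎ z ≈ x ⋎ (y ⋎ z)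
  ⋎-assoc x y z = ¬-injective (begin
    ¬ ((x ⋎ y) ⋎ z)       ≈⟨ ¬-⋎ (x ⋎ y) z ⟩
    ¬ (x ⋎ y) ⋏ ¬ z       ≈⟨ ⋏-cong (¬-⋎ x y) refl ⟩
    (¬ x ⋏ ¬ y) ⋏ ¬ z     ≈⟨ ⋏-assoc (¬ x) (¬ y) (¬ z) ⟩
    ¬ x ⋏ (¬ y ⋏ ¬ z)     ≈⟨ ⋏-cong refl (¬-⋎ y z) ⟨
    ¬ x ⋏ ¬ (y ⋎ z)       ≈⟨ ¬-⋎ x (y ⋎ z) ⟨
    ¬ (x ⋎ (y ⋎ z))       ∎)

  ¬-⋎T : ∀ x → ¬ (x ⋎ T) ≈ ¬ x ⋏ F
  ¬-⋎T x = trans (¬-⋎ x T) (⋏-cong refl ¬T≈F)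

  ⋎T-¬ : ∀ x → x ⋎ T ≈ ¬ x ⋎ T
  ⋎T-¬ x = ¬-injective (trans (¬-⋎T x) (trans (⋏F-¬ (¬ x)) (sym (¬-⋎T (¬ x)))))

  -- The dual of `SCL10`: negation turns `z ⋎ T` into `¬ z ⋏ F`.
  ⋏-⋎T-distribʳ : ∀ x y z → (x ⋎ y) ⋏ (z ⋎ T) ≈ (x ⋏ (z ⋎ T)) ⋎ (y ⋏ (z ⋎ T))
  ⋏-⋎T-distribʳ x y z = ¬-injective (begin
    ¬ ((x ⋎ y) ⋏ w)                      ≈⟨ ¬-⋏ (x ⋎ y) w ⟩
    ¬ (x ⋎ y) ⋎ ¬ w                      ≈⟨ ⋎-cong (¬-⋎ x y) (¬-⋎T z) ⟩
    (¬ x ⋏ ¬ y) ⋎ (¬ z ⋏ F)              ≈⟨ ⋎-⋏F-distribʳ (¬ x) (¬ y) (¬ z) ⟩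
    (¬ x ⋎ (¬ z ⋏ F)) ⋏ (¬ y ⋎ (¬ z ⋏ F)) ≈⟨ ⋏-cong (back x) (back y) ⟩
    ¬ (x ⋏ w) ⋏ ¬ (y ⋏ w)                ≈⟨ ¬-⋎ (x ⋏ w) (y ⋏ w) ⟨
    ¬ ((x ⋏ w) ⋎ (y ⋏ w))                ∎)
    where
    w = z ⋎ T
    back : ∀ u → ¬ u ⋎ (¬ z ⋏ F) ≈ ¬ (u ⋏ w)
    back u = trans (⋎-cong refl (sym (¬-⋎T z))) (sym (¬-⋏ u w))

  ⋎T-⋏F : ∀ x → (x ⋎ T) ⋏ F ≈ x ⋏ F
  ⋎T-⋏F x = trans (sym (⋏F-⋎ x F)) (⋎-identityʳ (x ⋏ F))

  -- Before `⋎ T` the result is irrelevant, so the conjunction may be negated and De Morgan applies.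
  ⋏-⋎T : ∀ x y → (x ⋏ y) ⋎ T ≈ ¬ x ⋎ (y ⋎ T)
  ⋏-⋎T x y = begin
    (x ⋏ y) ⋎ T       ≈⟨ ⋎T-¬ (x ⋏ y) ⟩
    ¬ (x ⋏ y) ⋎ T     ≈⟨ ⋎-cong (¬-⋏ x y) refl ⟩
    (¬ x ⋎ ¬ y) ⋎ T   ≈⟨ ⋎-assoc (¬ x) (¬ y) T ⟩
    ¬ x ⋎ (¬ y ⋎ T)   ≈⟨ ⋎-cong refl (⋎T-¬ y) ⟨
    ¬ x ⋎ (y ⋎ T)     ∎

  -- Terms all of whose exits are T.
  Total : Term (SCL A) → Set a
  Total t = t ⋎ T ≈ t

  ⋎-total : ∀ x {t} → Total t → Total (x ⋎ t)
  ⋎-total x ht = trans (⋎-assoc x _ T) (⋎-cong refl ht)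

  shape-total : ∀ s → Total (shapeTerm s)
  shape-total end          = ⋎-zeroˡ T
  shape-total (node i s t) = ⋎-total _ (shape-total t)

  module _ {t} (ht : Total t) where

    total-⋎ : ∀ x → t ⋎ x ≈ t
    total-⋎ x = begin
      t ⋎ x         ≈⟨ ⋎-cong ht refl ⟨
      (t ⋎ T) ⋎ x   ≈⟨ ⋎-assoc t T x ⟩
      t ⋎ (T ⋎ x)   ≈⟨ ⋎-cong refl (⋎-zeroˡ x) ⟩
      t ⋎ T         ≈⟨ ht ⟩
      t             ∎

    ¬-total : ¬ t ≈ t ⋏ F
    ¬-total = trans (¬-cong (sym ht)) (trans (¬-⋎T t) (sym (⋏F-¬ t)))

    total-⋏F-⋎ : ∀ x → (t ⋏ F) ⋎ x ≈ t ⋏ x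
    total-⋏F-⋎ x = trans (⋏F-⋎ t x) (⋏-cong ht refl)

    total-⋏F-⋎T : (t ⋏ F) ⋎ T ≈ t
    total-⋏F-⋎T = trans (total-⋏F-⋎ T) (⋏-identityʳ t)

    ¬-total-⋏F : ¬ (t ⋏ F) ≈ t
    ¬-total-⋏F = trans (¬-cong (sym ¬-total)) (¬¬ t)

    ¬-total-⋏ : ∀ x → ¬ (t ⋏ x) ≈ t ⋏ ¬ x
    ¬-total-⋏ x = begin
      ¬ (t ⋏ x)       ≈⟨ ¬-⋏ t x ⟩
      ¬ t ⋎ ¬ x       ≈⟨ ⋎-cong ¬-total refl ⟩
      (t ⋏ F) ⋎ ¬ x   ≈⟨ total-⋏F-⋎ (¬ x) ⟩
      t ⋏ ¬ x         ∎

    -- Brings the total term at exit `T` to the outside, where further conjuncts can be attached. It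
    -- is `SCL10` with the disjunct absorbed by `t`.
    exits-swap : ∀ x z → (x ⋏ t) ⋎ (z ⋏ F) ≈ (x ⋎ (z ⋏ F)) ⋏ t
    exits-swap x z = trans (⋎-⋏F-distribʳ x t z) (⋏-cong refl (total-⋎ (z ⋏ F)))

    ⋏-total-distribʳ : ∀ x y → (x ⋎ y) ⋏ t ≈ (x ⋏ t) ⋎ (y ⋏ t)
    ⋏-total-distribʳ x y = trans (⋏-cong refl (sym ht))
      (trans (⋏-⋎T-distribʳ x y t) (⋎-cong (⋏-cong refl ht) (⋏-cong refl ht)))

    -- Produces a `⋏ F` disjunct for `SCL10`, and an outer `⋎ T` under which negation has no effect.
    ⋎-total-as-⋏F : ∀ x → x ⋎ t ≈ (x ⋎ (t ⋏ F)) ⋎ T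
    ⋎-total-as-⋏F x = sym (trans (⋎-assoc x (t ⋏ F) T) (⋎-cong refl total-⋏F-⋎T))

  module _ {t f} (ht : Total t) (hf : Total f) where

    ¬-exits : ∀ x → ¬ ((x ⋏ t) ⋎ (f ⋏ F)) ≈ (¬ x ⋏ f) ⋎ (t ⋏ F)
    ¬-exits x = begin
      ¬ ((x ⋏ t) ⋎ (f ⋏ F))   ≈⟨ ¬-⋎ (x ⋏ t) (f ⋏ F) ⟩
      ¬ (x ⋏ t) ⋏ ¬ (f ⋏ F)   ≈⟨ ⋏-cong (¬-⋏ x t) (¬-total-⋏F hf) ⟩
      (¬ x ⋎ ¬ t) ⋏ f         ≈⟨ ⋏-cong (⋎-cong refl (¬-total ht)) refl ⟩
      (¬ x ⋎ (t ⋏ F)) ⋏ f     ≈⟨ exits-swap hf (¬ x) t ⟨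
      (¬ x ⋏ f) ⋎ (t ⋏ F)     ∎

    -- Both sides always yield `T`, so the whole may be negated under an outer `⋎ T`, and `¬-exits`
    -- then exchanges `t` and `f`.
    exits-¬ : ∀ x → (¬ x ⋏ t) ⋎ f ≈ (x ⋏ f) ⋎ t
    exits-¬ x = begin
      (¬ x ⋏ t) ⋎ f                     ≈⟨ ⋎-total-as-⋏F hf (¬ x ⋏ t) ⟩
      ((¬ x ⋏ t) ⋎ (f ⋏ F)) ⋎ T         ≈⟨ ⋎T-¬ _ ⟩
      ¬ ((¬ x ⋏ t) ⋎ (f ⋏ F)) ⋎ T       ≈⟨ ⋎-cong (¬-exits (¬ x)) refl ⟩
      ((¬ ¬ x ⋏ f) ⋎ (t ⋏ F)) ⋎ T       ≈⟨ ⋎-cong (⋎-cong (⋏-cong (¬¬ x) refl) refl) refl ⟩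
      ((x ⋏ f) ⋎ (t ⋏ F)) ⋎ T           ≈⟨ ⋎-total-as-⋏F ht (x ⋏ f) ⟨
      (x ⋏ f) ⋎ t                       ∎

  -- On the right, `y ⋎ f` is total, so the outer `f` is run only when `x` fails and the inner one
  -- only when `y` fails. Both sides reduce to `¬ x' ⋎ (y ⋎ f)`.
  exits-⋏ : ∀ {f} → Total f → ∀ x y → (x ⋏ y) ⋎ f ≈ (x ⋏ (y ⋎ f)) ⋎ f
  exits-⋏ {f} hf x y = begin
    (x ⋏ y) ⋎ f                           ≈⟨ ⋎-total-as-⋏F hf (x ⋏ y) ⟩
    ((x ⋏ y) ⋎ (f ⋏ F)) ⋎ T               ≈⟨ ⋎-cong (⋎-⋏F-distribʳ x y f) refl ⟩
    (x' ⋏ (y ⋎ (f ⋏ F))) ⋎ T              ≈⟨ ⋏-⋎T x' (y ⋎ (f ⋏ F)) ⟩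
    ¬ x' ⋎ ((y ⋎ (f ⋏ F)) ⋎ T)            ≈⟨ ⋎-cong refl (⋎-total-as-⋏F hf y) ⟨
    ¬ x' ⋎ (y ⋎ f)                        ≈⟨ ⋎-cong refl (⋎-total y hf) ⟨
    ¬ x' ⋎ ((y ⋎ f) ⋎ T)                  ≈⟨ ⋏-⋎T x' (y ⋎ f) ⟨
    (x' ⋏ (y ⋎ f)) ⋎ T                    ≈⟨ ⋎-cong (exits-swap (⋎-total y hf) x f) refl ⟨
    ((x ⋏ (y ⋎ f)) ⋎ (f ⋏ F)) ⋎ T         ≈⟨ ⋎-total-as-⋏F hf (x ⋏ (y ⋎ f)) ⟨
    (x ⋏ (y ⋎ f)) ⋎ f                     ∎
    where x' = x ⋎ (f ⋏ F)

  -- Operations on shapes, stars and normal forms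

  infixr 7 _⨟_
  _⨟_ : Shape A → Shape A → Shape A
  end        ⨟ u = u
  node i s t ⨟ u = node i (s ⨟ u) (t ⨟ u)

  ⨟-sound : ∀ s u → shapeTerm s ⋏ shapeTerm u ≈ shapeTerm (s ⨟ u)
  ⨟-sound end u = ⋏-identityˡ _
  ⨟-sound (node i s t) u = trans (⋏-total-distribʳ (shape-total u) _ _)
    (⋎-cong (trans (⋏-assoc _ _ _) (⋏-cong refl (⨟-sound s u))) (⨟-sound t u))

  -- The shape must run before every exit `T`: in a conjunction these are exits of the second factor
  -- only, in a disjunction of both factors.
  append : Star A b → Shape A → Star A b
  append (lit d i s t)    u = lit d i (s ⨟ u) t
  append (join true x y)  u = join true x (append y u)
  append (join false x y) u = join false (append x u) (append y u)

  append-sound : ∀ (x : Star A b) u → starTerm x ⋏ shapeTerm u ≈ starTerm (append x u)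
  -- `exits-swap` takes the first shape outside, where it is composed with `u`, and then puts the
  -- composite back.
  append-sound (lit d i s t) u = begin
    ((l ⋏ s′) ⋎ (t′ ⋏ F)) ⋏ u′    ≈⟨ ⋏-cong (exits-swap (shape-total s) l t′) refl ⟩
    ((l ⋎ (t′ ⋏ F)) ⋏ s′) ⋏ u′    ≈⟨ ⋏-assoc _ _ _ ⟩
    (l ⋎ (t′ ⋏ F)) ⋏ (s′ ⋏ u′)    ≈⟨ ⋏-cong refl (⨟-sound s u) ⟩
    (l ⋎ (t′ ⋏ F)) ⋏ shapeTerm (s ⨟ u) ≈⟨ exits-swap (shape-total (s ⨟ u)) l t′ ⟨
    (l ⋏ shapeTerm (s ⨟ u)) ⋎ (t′ ⋏ F) ∎
    where
    l  = literal d i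
    s′ = shapeTerm s
    t′ = shapeTerm t
    u′ = shapeTerm u
  append-sound (join true x y)  u = trans (⋏-assoc _ _ _) (⋏-cong refl (append-sound y u))
  append-sound (join false x y) u =
    trans (⋏-total-distribʳ (shape-total u) _ _) (⋎-cong (append-sound x u) (append-sound y u))

  ¬-star : Star A b → Star A (opposite b)
  ¬-star (lit d i s t) = lit (opposite d) i t s
  ¬-star (join b x y)  = join (opposite b) (¬-star x) (¬-star y)

  ¬-literal : ∀ d i → ¬ literal d i ≈ literal (opposite d) i
  ¬-literal true  i = refl
  ¬-literal false i = ¬¬ _

  ¬-star-sound : ∀ (x : Star A b) → ¬ starTerm x ≈ starTerm (¬-star x)
  ¬-star-sound (lit d i s t) = trans (¬-exits (shape-total s) (shape-total t) (literal d i))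
    (⋎-cong (⋏-cong (¬-literal d i) refl) refl)
  ¬-star-sound (join true x y)  = trans (¬-⋏ _ _) (⋎-cong (¬-star-sound x) (¬-star-sound y))
  ¬-star-sound (join false x y) = trans (¬-⋎ _ _) (⋏-cong (¬-star-sound x) (¬-star-sound y))

  ¬-core : Core A → Core A
  ¬-core (con b)  = con (opposite b)
  ¬-core (star x) = star (¬-star x)

  ¬-core-sound : ∀ x → ¬ coreTerm x ≈ coreTerm (¬-core x)
  ¬-core-sound (con true)  = ¬T≈F
  ¬-core-sound (con false) = ¬F≈T
  ¬-core-sound (star x)    = ¬-star-sound x

  -- Conjunctions are reassociated to the left, because the second factor of a `join true` must not
  -- itself be a conjunction.
  ⋏-star : Star A b → Star A c → Star A true
  ⋏-star x (lit d i s t)    = join true x (lit d i s t)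
  ⋏-star x (join true y z)  = join true (⋏-star x y) z
  ⋏-star x (join false y z) = join true x (join false y z)

  ⋏-star-sound : ∀ (x : Star A b) (y : Star A c) → starTerm x ⋏ starTerm y ≈ starTerm (⋏-star x y)
  ⋏-star-sound x (lit d i s t)    = refl
  ⋏-star-sound x (join true y z)  = trans (sym (⋏-assoc _ _ _)) (⋏-cong (⋏-star-sound x y) refl)
  ⋏-star-sound x (join false y z) = refl

  -- Continuation style: `s` and `t` say how evaluation goes on after `P` yields `T` or `F`.
  run : {P : Term (SCL A)} → Closed P → Shape A → Shape A → Shape A
  run (op {true} {[]} [])                  s t = s
  run (op {false} {[]} [])                 s t = t
  run (op {atom i} {[]} [])                s t = node i s t
  run (op {not} {_ ∷ []} (p ∷ []))         s t = run p t s
  run (op {and} {_ ∷ _ ∷ []} (p ∷ q ∷ [])) s t = run p (run q s t) t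
  run (op {or} {_ ∷ _ ∷ []} (p ∷ q ∷ []))  s t = run p s (run q s t)

  run-sound : ∀ {P} (p : Closed P) s t → (P ⋏ shapeTerm s) ⋎ shapeTerm t ≈ shapeTerm (run p s t)
  run-sound (op {true} {[]} [])    s t = trans (⋎-cong (⋏-identityˡ _) refl) (total-⋎ (shape-total s) _)
  run-sound (op {false} {[]} [])   s t = trans (⋎-cong (⋏-zeroˡ _) refl) (⋎-identityˡ _)
  run-sound (op {atom i} {[]} [])  s t = refl
  run-sound (op {not} {P ∷ []} (p ∷ [])) s t =
    trans (exits-¬ (shape-total s) (shape-total t) P) (run-sound p t s)
  run-sound (op {and} {P ∷ Q ∷ []} (p ∷ q ∷ [])) s t = begin
    ((P ⋏ Q) ⋏ s′) ⋎ t′               ≈⟨ ⋎-cong (⋏-assoc P Q s′) refl ⟩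
    (P ⋏ (Q ⋏ s′)) ⋎ t′               ≈⟨ exits-⋏ (shape-total t) P (Q ⋏ s′) ⟩
    (P ⋏ ((Q ⋏ s′) ⋎ t′)) ⋎ t′        ≈⟨ ⋎-cong (⋏-cong refl (run-sound q s t)) refl ⟩
    (P ⋏ shapeTerm (run q s t)) ⋎ t′  ≈⟨ run-sound p (run q s t) t ⟩
    shapeTerm (run p (run q s t) t)   ∎
    where
    s′ = shapeTerm s
    t′ = shapeTerm t
  -- A disjunction is a negated conjunction: `exits-¬` exchanges the exits, `exits-⋏` splits as in
  -- the case of `and`, and `exits-¬` then removes the inner negations.
  run-sound (op {or} {P ∷ Q ∷ []} (p ∷ q ∷ [])) s t = begin
    ((P ⋎ Q) ⋏ s′) ⋎ t′                 ≈⟨ ⋎-cong (⋏-cong (⋎-def P Q) refl) refl ⟩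
    (¬ (¬ P ⋏ ¬ Q) ⋏ s′) ⋎ t′           ≈⟨ exits-¬ (shape-total s) (shape-total t) _ ⟩
    ((¬ P ⋏ ¬ Q) ⋏ t′) ⋎ s′             ≈⟨ ⋎-cong (⋏-assoc (¬ P) (¬ Q) t′) refl ⟩
    (¬ P ⋏ (¬ Q ⋏ t′)) ⋎ s′             ≈⟨ exits-⋏ (shape-total s) (¬ P) (¬ Q ⋏ t′) ⟩
    (¬ P ⋏ ((¬ Q ⋏ t′) ⋎ s′)) ⋎ s′
      ≈⟨ ⋎-cong (⋏-cong refl (trans (exits-¬ (shape-total t) (shape-total s) Q) (run-sound q s t))) refl ⟩
    (¬ P ⋏ shapeTerm (run q s t)) ⋎ s′  ≈⟨ exits-¬ (shape-total (run q s t)) (shape-total s) P ⟩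
    (P ⋏ s′) ⋎ shapeTerm (run q s t)    ≈⟨ run-sound p s (run q s t) ⟩
    shapeTerm (run p s (run q s t))     ∎
    where
    s′ = shapeTerm s
    t′ = shapeTerm t

  Normal : Term (SCL A) → Set a
  Normal P = ∃ λ n → P ≈ nfTerm n

  ¬-normal : ∀ {P} → Normal P → Normal (¬ P)
  ¬-normal (s ∙ x , P≈) = s ∙ ¬-core x ,
    trans (¬-cong P≈) (trans (¬-total-⋏ (shape-total s) _) (⋏-cong refl (¬-core-sound x)))

  ⋏-normal : ∀ {P Q} → Closed P → Normal P → Normal Q → Normal (P ⋏ Q)
  ⋏-normal {P} {Q} p (s ∙ con false , P≈) _ = s ∙ con false , (begin
    P ⋏ Q                      ≈⟨ ⋏-cong P≈ refl ⟩
    (shapeTerm s ⋏ F) ⋏ Q      ≈⟨ ⋏-assoc _ _ _ ⟩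
    shapeTerm s ⋏ (F ⋏ Q)      ≈⟨ ⋏-cong refl (⋏-zeroˡ Q) ⟩
    shapeTerm s ⋏ F            ∎)
  ⋏-normal {P} {Q} p (s ∙ con true , P≈) (u ∙ y , Q≈) = (s ⨟ u) ∙ y , (begin
    P ⋏ Q                                         ≈⟨ ⋏-cong P≈ Q≈ ⟩
    (shapeTerm s ⋏ T) ⋏ (shapeTerm u ⋏ coreTerm y) ≈⟨ ⋏-cong (⋏-identityʳ _) refl ⟩
    shapeTerm s ⋏ (shapeTerm u ⋏ coreTerm y)      ≈⟨ ⋏-assoc _ _ _ ⟨
    (shapeTerm s ⋏ shapeTerm u) ⋏ coreTerm y      ≈⟨ ⋏-cong (⨟-sound s u) refl ⟩
    shapeTerm (s ⨟ u) ⋏ coreTerm y                ∎)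
  ⋏-normal {P} {Q} p (s ∙ star x , P≈) (u ∙ con true , Q≈) = s ∙ star (append x u) , (begin
    P ⋏ Q                                         ≈⟨ ⋏-cong P≈ (trans Q≈ (⋏-identityʳ _)) ⟩
    (shapeTerm s ⋏ starTerm x) ⋏ shapeTerm u      ≈⟨ ⋏-assoc _ _ _ ⟩
    shapeTerm s ⋏ (starTerm x ⋏ shapeTerm u)      ≈⟨ ⋏-cong refl (append-sound x u) ⟩
    shapeTerm s ⋏ starTerm (append x u)           ∎)
  -- The result is `F` whatever `P` yields, so all of `P` dissolves into the prefix: `u` follows its
  -- exit `T` and nothing follows its exit `F`.
  ⋏-normal {P} {Q} p (s ∙ star x , P≈) (u ∙ con false , Q≈) = run p u end ∙ con false , (begin
    P ⋏ Q                            ≈⟨ ⋏-cong refl Q≈ ⟩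
    P ⋏ (shapeTerm u ⋏ F)            ≈⟨ ⋏-assoc _ _ _ ⟨
    (P ⋏ shapeTerm u) ⋏ F            ≈⟨ ⋎T-⋏F _ ⟨
    ((P ⋏ shapeTerm u) ⋎ T) ⋏ F      ≈⟨ ⋏-cong (run-sound p u end) refl ⟩
    shapeTerm (run p u end) ⋏ F      ∎)
  -- The prefix `u` runs only after `x` has yielded `T`, so it moves into `x`.
  ⋏-normal {P} {Q} p (s ∙ star x , P≈) (u ∙ star y , Q≈) = s ∙ star (⋏-star (append x u) y) , (begin
    P ⋏ Q                                                       ≈⟨ ⋏-cong P≈ Q≈ ⟩
    (shapeTerm s ⋏ starTerm x) ⋏ (shapeTerm u ⋏ starTerm y)     ≈⟨ ⋏-assoc _ _ _ ⟩
    shapeTerm s ⋏ (starTerm x ⋏ (shapeTerm u ⋏ starTerm y))     ≈⟨ ⋏-cong refl (⋏-assoc _ _ _) ⟨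
    shapeTerm s ⋏ ((starTerm x ⋏ shapeTerm u) ⋏ starTerm y)
      ≈⟨ ⋏-cong refl (trans (⋏-cong (append-sound x u) refl) (⋏-star-sound (append x u) y)) ⟩
    shapeTerm s ⋏ starTerm (⋏-star (append x u) y)              ∎)

  normalise : ∀ {P} → Closed P → Normal P
  normalise (op {true} {[]} [])   = end ∙ con true , sym (⋏-identityˡ T)
  normalise (op {false} {[]} [])  = end ∙ con false , sym (⋏-identityˡ F)
  normalise (op {atom i} {[]} []) = end ∙ star (lit {b = true} true i end end) ,
    sym (trans (⋏-identityˡ _) (trans (⋎-cong (⋏-identityʳ _) (⋏-identityˡ F)) (⋎-identityʳ _)))
  normalise (op {not} {_ ∷ []} (p ∷ [])) = ¬-normal (normalise p)
  normalise (op {and} {_ ∷ _ ∷ []} (p ∷ q ∷ [])) = ⋏-normal p (normalise p) (normalise q)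
  normalise (op {or} {P ∷ Q ∷ []} (p ∷ q ∷ []))
    with n , eq ← ¬-normal (⋏-normal (op {f = not} {ts = P ∷ []} (p ∷ []))
                              (¬-normal (normalise p)) (¬-normal (normalise q))) =
    n , trans (⋎-def P Q) eq

-- Completeness for closed terms

theorem2 : ∀ {a} (A : Set a) → A ↣ ℕ →
    (P Q : Term (SCL A)) → Closed P → Closed Q →
    FSCL A ⊢ embed P ≈ embed Q → EqFSCL A ⊢ P ≈ Q
theorem2 A _ P Q p q P≈Q
  with m , P≈m ← Derivation.normalise A p
  with n , Q≈n ← Derivation.normalise A q =
  trans P≈m (≡.subst (EqFSCL A ⊢_≈ Q) (≡.sym (nf-injective m n same-tree)) (sym Q≈n))
  where
  -- Soundness of `EqFSCL` links each term to its normal form, and soundness of `FSCL` links the two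
  -- terms.
  same-tree : nfTree m ≡ nfTree n
  same-tree = begin
    nfTree m         ≡⟨ tree-nf m ⟨
    tree (nfTerm m)  ≡⟨ tree-sound P≈m ⟨
    tree P           ≡⟨ FSCL-tree-sound P Q P≈Q ⟩
    tree Q           ≡⟨ tree-sound Q≈n ⟩
    tree (nfTerm n)  ≡⟨ tree-nf n ⟩
    nfTree n         ∎
    where open ≡.≡-Reasoning
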